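{- Let $p\geq 2$ be an integer, $n=2^p-1$ and $s=3\cdot 2^{p-2}$. Then there exists a perfect code $C$ in the hypercube $Q_n$ such that no element of $C$ contains $1^s$ as a substring.
   Context: The $n$-cube $Q_n$ is the graph whose vertex set is the set $\mathbb{B}_n$ of binary strings of length $n$, two strings being adjacent if they differ in exactly one position; its graph distance is the Hamming distance. A perfect code in a graph $G$ is a set $C$ of vertices such that every vertex of $G$ lies in the closed neighbourhood $N[c]=\{v: d_G(c,v)\le 1\}$ of exactly one vertex $c\in C$ (equivalently, $C$ is a dominating set and any two distinct elements of $C$ are at distance at least $3$). $1^s$ denotes the string of $s$ consecutive 1's; a string $\bm{f}$ is a substring of $\bm{s}$ if $\bm{s}=\bm{x}\bm{f}\bm{y}$ for some (possibly empty) strings $\bm{x},\bm{y}$. -}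

module Defs where

open import Data.Bool using (Bool; true)
open import Data.List using (List; _++_; replicate)
open import Data.Nat using (ℕ; zero; suc; _≤_)
open import Data.Product using (∃; ∃₂; ∃!; _×_; _,_)
open import Data.Vec using (Vec; lookup; toList)
open import Level using (0ℓ)
open import Relation.Binary.Core using (Rel)
open import Relation.Binary.Definitions using (Symmetric; Irreflexive)
open import Relation.Binary.PropositionalEquality using (_≡_; _≢_; refl; sym)
open import Relation.Unary using (Pred; _∈_)

record Graph : Set₁ where
  field
    Vertex  : Set
    Adj     : Rel Vertex 0ℓ
    adj-sym : Symmetric Adj
    irrefl  : Irreflexive _≡_ Adj

module _ (G : Graph) where
  open Graph G

  data Walk : ℕ → Rel Vertex 0ℓ where
    []  : ∀ {u} → Walk zero u u
    _∷_ : ∀ {k u v w} → Adj u v → Walk k v w → Walk (suc k) u w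

  -- "d_G(u,v) ≤ k": the distance is the minimum length of a walk from u to v.
  Dist≤ : ℕ → Rel Vertex 0ℓ
  Dist≤ k u v = ∃ λ l → l ≤ k × Walk l u v

  N[_] : Vertex → Pred Vertex 0ℓ
  N[ c ] v = Dist≤ 1 c v

  PerfectCode : Pred Vertex 0ℓ → Set
  PerfectCode C = ∀ v → ∃! _≡_ λ c → c ∈ C × v ∈ N[ c ]

BinaryString : ℕ → Set
BinaryString n = Vec Bool n

DifferInExactlyOne : ∀ {n} → Rel (BinaryString n) 0ℓ
DifferInExactlyOne u v = ∃! _≡_ λ i → lookup u i ≢ lookup v i

Q : ℕ → Graph
Q n = record
  { Vertex  = BinaryString n
  ; Adj     = DifferInExactlyOne
  ; adj-sym = λ { (i , u≢v , unique) →
      i , (λ v≡u → u≢v (sym v≡u)) , λ v≢u → unique (λ u≡v → v≢u (sym u≡v)) }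
  ; irrefl  = λ { refl (_ , u≢u , _) → u≢u refl }
  }

_IsSubstringOf_ : List Bool → List Bool → Set
f IsSubstringOf s = ∃₂ λ x y → s ≡ x ++ f ++ y

1^ : ℕ → List Bool
1^ s = replicate s true

_Contains_ : ∀ {n} → BinaryString n → List Bool → Set
c Contains f = f IsSubstringOf toList c

{-# OPTIONS --safe #-}

-- From a perfect code C in Q_{a+b} one obtains a perfect code in Q_{2(a+b)+1}: the words x₁ y₀ y x₂ with
-- |x₁| = a, |y| = a + b, |x₂| = b such that x₁x₂ ⊕ y lies in C and y₀y has odd parity.
-- Taking a = 0 repeatedly yields perfect codes in all Q_{2^q-1}. In the last step take
-- a = 2^{p-2} - 1 and b = 2^{p-2}: a run of 3·2^{p-2} ones leaves only a positions uncovered, hence covers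
-- the block y₀y, whose length 2^{p-1} is even, against its odd parity.
module Submission where

open import Data.Bool using (Bool; true; false; not; _xor_; _≟_)
open import Data.Bool.Properties using (¬-not; not-¬; not-injective; xor-same; xor-assoc; xor-comm; xor-identityʳ; xor-inverseˡ)
open import Data.Empty using (⊥-elim)
open import Data.Fin using (zero; suc)
open import Data.Fin.Properties using () renaming (suc-injective to Fin-suc-injective)
open import Data.List using (List; replicate; length) renaming ([] to []ˡ; _∷_ to _∷ˡ_; _++_ to _++ˡ_)
open import Data.List.Properties using (length-++; length-replicate) renaming (∷-injective to ∷ˡ-injective; ++-assoc to ++ˡ-assoc)
open import Data.List.Relation.Unary.All as All using (All)
open import Data.List.Relation.Unary.All.Properties using (++⁻ʳ)
open import Data.Nat using (ℕ; zero; suc; _+_; _*_; _∸_; _^_; _≤_; z≤n; s≤s)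
open import Data.Nat.Properties using (+-cancelˡ-≡; m≤m+n; m≤n+m; m≤n⇒m≤1+n; ≤-trans; ≤-reflexive; 1+n≰n; suc-injective; suc-pred; m^n≢0)
open import Data.Nat.Tactic.RingSolver using (solve-∀)
open import Data.Product using (∃; _×_; _,_; proj₂)
open import Data.Sum using (_⊎_; inj₁; inj₂)
open import Data.Unit using (⊤; tt)
open import Data.Vec as Vec using (Vec; []; _∷_; _++_; lookup; toList; zipWith; splitAt)
open import Data.Vec.Properties using (++-injective; zipWith-comm; toList-++; length-toList)
open import Data.Vec.Relation.Binary.Pointwise.Extensional using (ext; Pointwise-≡⇒≡)
open import Relation.Binary.PropositionalEquality using (_≡_; _≢_; refl; sym; trans; cong; cong₂; subst; subst₂; module ≡-Reasoning)
open import Level using (0ℓ)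
open import Relation.Nullary using (¬_; yes; no; contradiction; decidable-stable)
open import Relation.Unary using (Pred; _∈_)
open import Defs

private
  variable
    a b m n : ℕ

-- Words at Hamming distance at most one.

data Near : BinaryString n → BinaryString n → Set where
  []   : Near [] []
  keep : ∀ x {u v : BinaryString n} → Near u v → Near (x ∷ u) (x ∷ v)
  flip : ∀ {x y} (u : BinaryString n) → x ≢ y → Near (x ∷ u) (y ∷ u)

Near-refl : (u : BinaryString n) → Near u u
Near-refl []      = []
Near-refl (x ∷ u) = keep x (Near-refl u)

-- Uniqueness of the differing index refutes a difference at any other index, and bits have
-- decidable equality, so the remaining bits agree.
differ⇒Near : {u v : BinaryString n} → DifferInExactlyOne u v → Near u v
differ⇒Near {u = x ∷ u} {y ∷ v} (zero , x≢y , unique)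
  with refl ← Pointwise-≡⇒≡ {xs = u} {v} (ext λ j → decidable-stable (lookup u j ≟ lookup v j)
                (λ u≢v → contradiction (unique {suc j} u≢v) λ ()))
  = flip u x≢y
differ⇒Near {u = x ∷ u} {y ∷ v} (suc i , u≢v , unique)
  with refl ← decidable-stable (x ≟ y) (λ x≢y → contradiction (unique {zero} x≢y) λ ())
  = keep x (differ⇒Near (i , u≢v , λ u≢v′ → Fin-suc-injective (unique u≢v′)))

Near⇒≡⊎differ : {u v : BinaryString n} → Near u v → u ≡ v ⊎ DifferInExactlyOne u v
Near⇒≡⊎differ [] = inj₁ refl
Near⇒≡⊎differ (keep x near) with Near⇒≡⊎differ near
... | inj₁ refl                 = inj₁ refl
... | inj₂ (i , u≢v , unique) = inj₂ (suc i , u≢v , λ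
  { {zero}  x≢x → ⊥-elim (x≢x refl)
  ; {suc j} u≢v′ → cong suc (unique u≢v′) })
Near⇒≡⊎differ (flip u x≢y) = inj₂ (zero , x≢y , λ
  { {zero}  _   → refl
  ; {suc j} u≢u → ⊥-elim (u≢u refl) })

-- Derivations of `Near` follow the word bit by bit, so unlike walks they can be cut at
-- concatenations.
N⇒Near : {u v : BinaryString n} → v ∈ N[_] (Q n) u → Near u v
N⇒Near (_ , _ , [])       = Near-refl _
N⇒Near (_ , _ , adj ∷ []) = differ⇒Near adj
N⇒Near (_ , s≤s () , _ ∷ (_ ∷ _))

Near⇒N : {u v : BinaryString n} → Near u v → v ∈ N[_] (Q n) u
Near⇒N near with Near⇒≡⊎differ near
... | inj₁ refl = 0 , z≤n , []
... | inj₂ adj  = 1 , s≤s z≤n , adj ∷ []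

Near-++ˡ : {u v : BinaryString m} (w : BinaryString n) → Near u v → Near (u ++ w) (v ++ w)
Near-++ˡ w []           = Near-refl w
Near-++ˡ w (keep x near) = keep x (Near-++ˡ w near)
Near-++ˡ w (flip u x≢y) = flip (u ++ w) x≢y

Near-++ʳ : (w : BinaryString m) {u v : BinaryString n} → Near u v → Near (w ++ u) (w ++ v)
Near-++ʳ []      near = near
Near-++ʳ (x ∷ w) near = keep x (Near-++ʳ w near)

Near-∷⁻ : ∀ {x y} {u v : BinaryString n} → Near (x ∷ u) (y ∷ v) → (x ≡ y × Near u v) ⊎ (x ≢ y × u ≡ v)
Near-∷⁻ (keep x near) = inj₁ (refl , near)
Near-∷⁻ (flip u x≢y)  = inj₂ (x≢y , refl)

-- The one difference lies on one side of the cut; equal words land in `inj₂`.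
Near-++⁻ : (u u′ : BinaryString m) {v v′ : BinaryString n} → Near (u ++ v) (u′ ++ v′) →
           (Near u u′ × v ≡ v′) ⊎ (u ≡ u′ × Near v v′)
Near-++⁻ []      []        near = inj₂ (refl , near)
Near-++⁻ (x ∷ u) (x′ ∷ u′) near with Near-∷⁻ near
... | inj₂ (x≢x′ , eq) with refl , refl ← ++-injective u u′ eq = inj₁ (flip u x≢x′ , refl)
... | inj₁ (refl , tails) with Near-++⁻ u u′ tails
...   | inj₁ (near-u , v≡v′) = inj₁ (keep x near-u , v≡v′)
...   | inj₂ (refl , near-v) = inj₂ (refl , near-v)

-- Bitwise sum and parity.

infixl 6 _⊕_

_⊕_ : BinaryString n → BinaryString n → BinaryString n
_⊕_ = zipWith _xor_

xor-cancelʳ : ∀ x y → (x xor y) xor y ≡ x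
xor-cancelʳ x y = trans (xor-assoc x y y) (trans (cong (x xor_) (xor-same y)) (xor-identityʳ x))

xor-injectiveˡ : ∀ z {x y} → x xor z ≡ y xor z → x ≡ y
xor-injectiveˡ z {x} {y} eq = trans (sym (xor-cancelʳ x z)) (trans (cong (_xor z) eq) (xor-cancelʳ y z))

xor-injectiveʳ : ∀ z {x y} → z xor x ≡ z xor y → x ≡ y
xor-injectiveʳ false eq = eq
xor-injectiveʳ true  eq = not-injective eq

⊕-cancelʳ : (u v : BinaryString n) → u ⊕ v ⊕ v ≡ u
⊕-cancelʳ []      []      = refl
⊕-cancelʳ (x ∷ u) (y ∷ v) = cong₂ _∷_ (xor-cancelʳ x y) (⊕-cancelʳ u v)

⊕-comm : (u v : BinaryString n) → u ⊕ v ≡ v ⊕ u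
⊕-comm = zipWith-comm xor-comm

⊕-cancelˡ : (u v : BinaryString n) → u ⊕ (v ⊕ u) ≡ v
⊕-cancelˡ u v = trans (⊕-comm u (v ⊕ u)) (⊕-cancelʳ v u)

⊕-injectiveˡ : (w : BinaryString n) {u v : BinaryString n} → u ⊕ w ≡ v ⊕ w → u ≡ v
⊕-injectiveˡ w {u} {v} eq = trans (sym (⊕-cancelʳ u w)) (trans (cong (_⊕ w) eq) (⊕-cancelʳ v w))

Near-⊕ʳ : (w : BinaryString n) {u v : BinaryString n} → Near u v → Near (u ⊕ w) (v ⊕ w)
Near-⊕ʳ []      []            = []
Near-⊕ʳ (z ∷ w) (keep x near) = keep (x xor z) (Near-⊕ʳ w near)
Near-⊕ʳ (z ∷ w) (flip u x≢y)  = flip (u ⊕ w) λ eq → x≢y (xor-injectiveˡ z eq)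

parity : BinaryString n → Bool
parity []      = false
parity (x ∷ u) = x xor parity u

parity-replicate-++ : ∀ m n → parity (Vec.replicate (m + n) true) ≡
                      parity (Vec.replicate m true) xor parity (Vec.replicate n true)
parity-replicate-++ zero    n = refl
parity-replicate-++ (suc m) n = trans (cong not (parity-replicate-++ m n))
  (sym (xor-assoc true (parity (Vec.replicate m true)) _))

-- A flip would change the parity.
Near∧parity⇒≡ : {u v : BinaryString n} → Near u v → parity u ≡ parity v → u ≡ v
Near∧parity⇒≡ []            eq = refl
Near∧parity⇒≡ (keep x near) eq = cong (x ∷_) (Near∧parity⇒≡ near (xor-injectiveʳ x eq))
Near∧parity⇒≡ (flip u x≢y)  eq = contradiction (xor-injectiveˡ (parity u) eq) x≢y

-- The left word is odd, the right one even. Either `u` and `v` agree and only the added bits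
-- differ, or their parities differ and the added bits agree.
Near-parity∷ : {u v : BinaryString n} → Near u v → Near (not (parity u) ∷ u) (parity v ∷ v)
Near-parity∷ {u = u} {v} near with parity u ≟ parity v
... | yes eq with refl ← Near∧parity⇒≡ near eq = flip u λ eq′ → not-¬ refl (sym eq′)
... | no neq = subst (λ z → Near (z ∷ u) (parity v ∷ v))
                 (¬-not λ eq → neq (sym eq)) (keep (parity v) near)

-- Doubling a perfect code.

data Doubled {a b} (C : Pred (BinaryString (a + b)) 0ℓ) : Pred (BinaryString (a + (suc (a + b) + b))) 0ℓ where
  -- Up to the order of coordinates this is Vasil'ev's construction with a constant function. The
  -- order matters here, since substrings depend on it.
  doubled : ∀ x₁ y₀ y x₂ → parity (y₀ ∷ y) ≡ true → (x₁ ++ x₂) ⊕ y ∈ C → Doubled C (x₁ ++ (y₀ ∷ y) ++ x₂)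

Near-insert⁻ : (x₁ x₁′ : BinaryString a) (y y′ : BinaryString m) {x₂ x₂′ : BinaryString b} →
               Near (x₁ ++ y ++ x₂) (x₁′ ++ y′ ++ x₂′) →
               (Near (x₁ ++ x₂) (x₁′ ++ x₂′) × y ≡ y′) ⊎ (x₁ ++ x₂ ≡ x₁′ ++ x₂′ × Near y y′)
Near-insert⁻ x₁ x₁′ y y′ {x₂} near with Near-++⁻ x₁ x₁′ near
... | inj₁ (near₁ , eq) with refl , refl ← ++-injective y y′ eq = inj₁ (Near-++ˡ x₂ near₁ , refl)
... | inj₂ (refl , near₂) with Near-++⁻ y y′ near₂
...   | inj₁ (near-y , refl) = inj₂ (refl , near-y)
...   | inj₂ (refl , near₃)  = inj₁ (Near-++ʳ x₁ near₃ , refl)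

Near-insert⁺ : (x₁ x₁′ : BinaryString a) (y : BinaryString m) {x₂ x₂′ : BinaryString b} →
               Near (x₁ ++ x₂) (x₁′ ++ x₂′) → Near (x₁ ++ y ++ x₂) (x₁′ ++ y ++ x₂′)
Near-insert⁺ x₁ x₁′ y {x₂} near with Near-++⁻ x₁ x₁′ near
... | inj₁ (near₁ , refl) = Near-++ˡ (y ++ x₂) near₁
... | inj₂ (refl , near₂) = Near-++ʳ x₁ (Near-++ʳ y near₂)

-- A flip in `x₁`, `x₂` or `y` flips one bit of the sum, a flip of `y₀` none.
Near-project : (x₁ x₁′ : BinaryString a) (y₀ y₀′ : Bool) (y y′ : BinaryString (a + b)) {x₂ x₂′ : BinaryString b} →
  Near (x₁ ++ (y₀ ∷ y) ++ x₂) (x₁′ ++ (y₀′ ∷ y′) ++ x₂′) →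
  Near ((x₁ ++ x₂) ⊕ y) ((x₁′ ++ x₂′) ⊕ y′)
Near-project x₁ x₁′ y₀ y₀′ y y′ {x₂} {x₂′} near with Near-insert⁻ x₁ x₁′ (y₀ ∷ y) (y₀′ ∷ y′) near
... | inj₁ (near-x , refl) = Near-⊕ʳ y near-x
... | inj₂ (eq , near-y) with Near-∷⁻ near-y
...   | inj₂ (_ , refl) = subst (λ x → Near ((x₁ ++ x₂) ⊕ y) (x ⊕ y)) eq (Near-refl _)
...   | inj₁ (_ , near-t) = subst (λ x → Near ((x₁ ++ x₂) ⊕ y) (x ⊕ y′)) eq
  (subst₂ Near (⊕-comm y _) (⊕-comm y′ _) (Near-⊕ʳ (x₁ ++ x₂) near-t))

module _ {a b} {C : Pred (BinaryString (a + b)) 0ℓ} (perfect : PerfectCode (Q (a + b)) C) where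

  private
    W = BinaryString (a + (suc (a + b) + b))

  unique-nearby : ∀ {c d v} → c ∈ C → d ∈ C → Near c v → Near d v → c ≡ d
  unique-nearby {v = v} c∈C d∈C c~v d~v with _ , _ , unique ← perfect v =
    trans (sym (unique (c∈C , Near⇒N c~v))) (unique (d∈C , Near⇒N d~v))

  -- Both codewords project to the same word of C, so they agree once their middle blocks or their outer
  -- parts do; a middle block at distance one from that of v has the opposite parity.
  doubled-unique : {c d v : W} → c ∈ Doubled {a} {b} C → d ∈ Doubled {a} {b} C → Near c v → Near d v → c ≡ d
  doubled-unique {v = v} (doubled x₁ y₀ y x₂ odd c∈C) (doubled x₁′ y₀′ y′ x₂′ odd′ d∈C) c~v d~v
    with z₁ , zs , refl ← splitAt a v
    with (w₀ ∷ w) , z₂ , refl ← splitAt (suc (a + b)) zs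
    with π≡π′ ← unique-nearby c∈C d∈C
           (Near-project x₁ z₁ y₀ w₀ y w c~v)
           (Near-project x₁′ z₁ y₀′ w₀ y′ w d~v)
    with Near-insert⁻ x₁ z₁ (y₀ ∷ y) (w₀ ∷ w) c~v | Near-insert⁻ x₁′ z₁ (y₀′ ∷ y′) (w₀ ∷ w) d~v
  ... | inj₁ (_ , refl) | inj₁ (_ , refl)
    with refl , refl ← ++-injective x₁ x₁′ (⊕-injectiveˡ y π≡π′) = refl
  ... | inj₁ (_ , refl) | inj₂ (eq , y′~w) with refl ← Near∧parity⇒≡ y′~w (trans odd′ (sym odd))
    with refl , refl ← ++-injective x₁ x₁′ (⊕-injectiveˡ y π≡π′) = refl
  ... | inj₂ (eq , y~w) | inj₁ (_ , refl) with refl ← Near∧parity⇒≡ y~w (trans odd (sym odd′))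
    with refl , refl ← ++-injective x₁ x₁′ (⊕-injectiveˡ y π≡π′) = refl
  ... | inj₂ (eq , _) | inj₂ (eq′ , _)
    with refl , refl ← ++-injective x₁ x₁′ (trans eq (sym eq′))
    with refl ← ⊕-injectiveˡ (x₁ ++ x₂) {y} {y′} (trans (⊕-comm y _) (trans π≡π′ (⊕-comm _ y′)))
    with refl ← xor-injectiveˡ (parity y) {y₀} {y₀′} (trans odd (sym odd′)) = refl

  -- If the middle block of v has odd parity the outer part is corrected, otherwise the middle block is.
  doubled-dominating : (v : W) → ∃ λ c → c ∈ Doubled {a} {b} C × Near c v
  doubled-dominating v
    with x₁ , xs , refl ← splitAt a v
    with (y₀ ∷ y) , x₂ , refl ← splitAt (suc (a + b)) xs
    with c , (c∈C , near) , _ ← perfect ((x₁ ++ x₂) ⊕ y)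
    with c~z ← N⇒Near near
    with parity (y₀ ∷ y) in eq
  ... | true with x₁′ , x₂′ , split ← splitAt a (c ⊕ y) =
    _ , doubled x₁′ y₀ y x₂′ eq (subst (_∈ C) (trans (sym (⊕-cancelʳ c y)) (cong (_⊕ y) split)) c∈C) ,
    Near-insert⁺ x₁′ x₁ (y₀ ∷ y) (subst₂ Near split (⊕-cancelʳ _ y) (Near-⊕ʳ y c~z))
  -- Even parity forces `y₀` to be `parity y`, the form that `Near-parity∷` expects.
  ... | false with refl ← xor-injectiveˡ (parity y) {y₀} {parity y} (trans eq (sym (xor-same (parity y)))) =
    _ , doubled x₁ (not (parity t)) t x₂ (xor-inverseˡ (parity t)) (subst (_∈ C) (sym (⊕-cancelˡ x c)) c∈C) ,
    Near-++ʳ x₁ (Near-++ˡ x₂ (Near-parity∷ t~y))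
    where
    x = x₁ ++ x₂
    -- The only middle block whose sum with the unchanged outer part `x` is `c`.
    t = c ⊕ x
    t~y : Near t y
    t~y = subst (Near t) (trans (cong (_⊕ x) (⊕-comm x y)) (⊕-cancelʳ y x)) (Near-⊕ʳ x c~z)

  doubled-perfect : PerfectCode (Q (a + (suc (a + b) + b))) (Doubled {a} {b} C)
  doubled-perfect v with c , c∈D , c~v ← doubled-dominating v =
    c , (c∈D , Near⇒N c~v) , λ (d∈D , near) → doubled-unique c∈D d∈D c~v (N⇒Near near)

-- Perfect codes in the cubes of dimension 2^q - 1.

∃-pred : ∀ q → ∃ λ k → 2 ^ q ≡ suc k
∃-pred q = 2 ^ q ∸ 1 , sym (suc-pred (2 ^ q) {{m^n≢0 2 q}})

k+[1+k] : ∀ k → k + (suc k + 0) ≡ suc k + k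
k+[1+k] = solve-∀

-- The dimension is given by `2 ^ q ≡ suc n` to keep truncated subtraction out of the induction.
perfect-code : ∀ q {n} → 2 ^ q ≡ suc n → ∃ λ (C : Pred (BinaryString n) 0ℓ) → PerfectCode (Q n) C
perfect-code zero    refl = (λ _ → ⊤) , λ where
  [] → [] , (tt , Near⇒N []) , λ { {[]} _ → refl }
perfect-code (suc q) {n} eq
  with k , 2^q≡1+k ← ∃-pred q
  -- Cancelling a successor in 2^(q+1) = 2(k+1) gives n = (k+1) + k, the word length of
  -- `Doubled {0} {k}`.
  with refl ← trans (suc-injective (trans (sym eq) (cong (2 *_) 2^q≡1+k))) (k+[1+k] k)
  with C , perfect ← perfect-code q 2^q≡1+k
  = Doubled {0} {k} C , doubled-perfect perfect

-- Positions of a long run.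

module _ {A : Set} where

  ++-suffix : (as : List A) {bs : List A} (xs : List A) {cs : List A} → as ++ˡ bs ≡ xs ++ˡ cs →
              length xs ≤ length as → ∃ λ ds → cs ≡ ds ++ˡ bs
  ++-suffix as        []ˡ       eq _ = as , sym eq
  ++-suffix (a ∷ˡ as) (x ∷ˡ xs) eq (s≤s le) = ++-suffix as xs (proj₂ (∷ˡ-injective eq)) le

  -- If the run were exhausted inside `ds`, then `zs` would contain all of `es` and at least one
  -- entry more.
  replicate-prefix : ∀ s {x : A} {zs : List A} (ds : List A) {es : List A} → replicate s x ++ˡ zs ≡ ds ++ˡ es →
                     length zs ≤ length es → All (_≡ x) ds
  replicate-prefix s       []ˡ       eq le = All.[]
  replicate-prefix (suc s) (d ∷ˡ ds) eq le with x≡d , eq′ ← ∷ˡ-injective eq =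
    sym x≡d All.∷ replicate-prefix s ds eq′ le
  replicate-prefix zero    (d ∷ˡ ds) {es} refl le = contradiction
    (≤-trans (s≤s (m≤n+m (length es) (length ds))) (≤-trans (≤-reflexive (cong suc (sym (length-++ ds)))) le)) 1+n≰n

All⇒≡replicate : ∀ {x} (u : BinaryString n) → All (_≡ x) (toList u) → u ≡ Vec.replicate n x
All⇒≡replicate []      _               = refl
All⇒≡replicate (_ ∷ u) (refl All.∷ us) = cong (_ ∷_) (All⇒≡replicate u us)

-- The run starts no later than `y` and ends no earlier.
long-run-covers : (u : BinaryString a) (y : BinaryString m) (v : BinaryString b) {s : ℕ} {xs zs : List Bool} →
  toList (u ++ y ++ v) ≡ xs ++ˡ 1^ s ++ˡ zs → length xs ≤ a → length zs ≤ b → y ≡ Vec.replicate m true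
long-run-covers u y v {s} {xs} {zs} eq xs≤ zs≤
  -- `ds` is what remains of `u` after `xs`; the run contains `ds` followed by `y`.
  with ds , eq′ ← ++-suffix (toList u) xs (trans (sym (toList-++ u (y ++ v))) eq)
                    (subst (length xs ≤_) (sym (length-toList u)) xs≤)
  = All⇒≡replicate y (++⁻ʳ ds (replicate-prefix s (ds ++ˡ toList y)
      (trans eq′ (trans (cong (ds ++ˡ_) (toList-++ y v)) (sym (++ˡ-assoc ds (toList y) (toList v)))))
      (subst (length zs ≤_) (sym (length-toList v)) zs≤)))

length-outside : (u : BinaryString n) {s k : ℕ} (xs : List Bool) {zs : List Bool} → n ≡ s + k →
                 toList u ≡ xs ++ˡ 1^ s ++ˡ zs → length xs + length zs ≡ k
length-outside {n} u {s} {k} xs {zs} n≡s+k eq = +-cancelˡ-≡ s _ _ (begin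
  s + (length xs + length zs)                ≡⟨ swap s (length xs) (length zs) ⟩
  length xs + (s + length zs)                ≡⟨ cong (λ l → length xs + (l + length zs)) (length-replicate s) ⟨
  length xs + (length (1^ s) + length zs)    ≡⟨ cong (length xs +_) (length-++ (1^ s)) ⟨
  length xs + length (1^ s ++ˡ zs)           ≡⟨ length-++ xs ⟨
  length (xs ++ˡ 1^ s ++ˡ zs)                ≡⟨ cong length eq ⟨
  length (toList u)                          ≡⟨ length-toList u ⟩
  n                                          ≡⟨ n≡s+k ⟩
  s + k                                      ∎)
  where
  open ≡-Reasoning
  swap : ∀ s x z → s + (x + z) ≡ x + (s + z)
  swap = solve-∀

-- The last doubling.

doubled-avoids : ∀ m (C : Pred (BinaryString (m + suc m)) 0ℓ) c →
                 c ∈ Doubled {m} {suc m} C → ¬ (c Contains 1^ (3 * suc m))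
doubled-avoids m C _ (doubled x₁ y₀ y x₂ odd _) (xs , zs , eq) = contradiction
  -- The all-ones block splits into two halves of length m+1, whose parities cancel.
  (trans (sym odd) (trans (cong parity y≡1) (trans (parity-replicate-++ (suc m) (suc m))
    (xor-same (parity (Vec.replicate (suc m) true))))))
  λ ()
  where
  total : ∀ m → m + (suc (m + suc m) + suc m) ≡ 3 * suc m + m
  total = solve-∀
  -- Of the 4m+3 positions the run takes 3(m+1). The m left over bound both sides: `x₁` has length m
  -- and `x₂` one more.
  lengths : length xs + length zs ≡ m
  lengths = length-outside (x₁ ++ (y₀ ∷ y) ++ x₂) {3 * suc m} xs (total m) eq
  y≡1 : y₀ ∷ y ≡ Vec.replicate (suc m + suc m) true
  y≡1 = long-run-covers x₁ (y₀ ∷ y) x₂ {3 * suc m} {xs} {zs} eq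
    (subst (length xs ≤_) lengths (m≤m+n _ _))
    (m≤n⇒m≤1+n (subst (length zs ≤_) lengths (m≤n+m _ _)))

2*[1+m] : ∀ m → 2 * suc m ≡ suc (m + suc m)
2*[1+m] = solve-∀

4*[1+m] : ∀ m → 2 * (2 * suc m) ≡ suc (m + (suc (m + suc m) + suc m))
4*[1+m] = solve-∀

theorem2 : (p n s : ℕ) → 2 ≤ p → n ≡ 2 ^ p ∸ 1 → s ≡ 3 * 2 ^ (p ∸ 2) →
    ∃ λ (C : Pred (BinaryString n) 0ℓ) → PerfectCode (Q n) C × (∀ c → c ∈ C → ¬ (c Contains 1^ s))
theorem2 (suc (suc q)) n s (s≤s (s≤s z≤n)) n≡ s≡
  -- With q = p - 2 and m = 2^q - 1 one has s = 3(m+1) and n = 4m+3.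
  with m , 2^q≡1+m ← ∃-pred q
  with refl ← trans s≡ (cong (3 *_) 2^q≡1+m)
  with refl ← trans n≡ (cong (_∸ 1) (trans (cong (λ k → 2 * (2 * k)) 2^q≡1+m) (4*[1+m] m)))
  -- The length 2^(q+1) - 1 = 2m+1 is now split as m + (m+1), placing the odd block near the centre.
  with C , perfect ← perfect-code (suc q) {m + suc m} (trans (cong (2 *_) 2^q≡1+m) (2*[1+m] m))
  = Doubled {m} {suc m} C , doubled-perfect perfect , doubled-avoids m C
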